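{- Let $t\in\mathbb{Q}$ be such that the six rational numbers $(t+i)^2$, $i\in\{0,\pm1,\pm2,3\}$, are pairwise distinct. Then there are infinitely many elliptic curves $C: y^2=ax^4+bx^2+c$ with $a,b,c\in\mathbb{Q}$ such that for every $i\in\{0,\pm1,\pm2,3\}$, $(t+i)^2$ is the $x$-coordinate of a point of $C(\mathbb{Q})$. In particular, there are infinitely many elliptic curves of the form $y^2=ax^4+bx^2+c$ over $\mathbb{Q}$ with $6$-term sequences of consecutive squares.
   Context: Let $C$ be an elliptic curve over $\mathbb{Q}$ given by $y^2=P(x)$ with $P\in\mathbb{Q}[x]$ of degree $3$ or $4$. A sequence of points $(x_i,y_i)\in C(\mathbb{Q})$, $i=1,\dots,n$, is a sequence of consecutive squares (of length $n$) if there is $u\in\mathbb{Q}$ with $x_i=(u+i)^2$ for $i=1,\dots,n$. -}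

module Defs where

open import Data.Nat using (ℕ; suc)
open import Data.Integer using (+_; -[1+_])
open import Data.Rational using (ℚ; 0ℚ; _+_; _*_; _-_; -_; _/_)
open import Data.Rational.Base using (+-*-rawSemiring)
open import Algebra.Definitions.RawSemiring +-*-rawSemiring public using (_^_)
open import Data.Fin using (Fin; toℕ)
open import Data.List using (List; []; _∷_)
open import Data.Product using (_×_; ∃-syntax; Σ-syntax)
open import Data.Sum using (_⊎_)
open import Relation.Binary.PropositionalEquality using (_≡_; _≢_)

fromℕ : ℕ → ℚ
fromℕ n = + n / 1

-- quartic a b c d e is the polynomial  a x⁴ + b x³ + c x² + d x + e.
record Quartic : Set where
  constructor quartic
  field
    a b c d e : ℚ

eval : Quartic → ℚ → ℚ
eval (quartic a b c d e) x =
  a * x ^ 4 + b * x ^ 3 + c * x ^ 2 + d * x + e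

-- The classical invariants of weights 4 and 6 of the binary quartic form
-- obtained by homogenising P to degree 4.
invI : Quartic → ℚ
invI (quartic a b c d e) =
  fromℕ 12 * a * e - fromℕ 3 * b * d + c ^ 2

invJ : Quartic → ℚ
invJ (quartic a b c d e) =
    fromℕ 72 * a * c * e + fromℕ 9 * b * c * d
  - fromℕ 27 * a * d ^ 2 - fromℕ 27 * e * b ^ 2 - fromℕ 2 * c ^ 3

-- 27 times the discriminant of the binary quartic form.  It is nonzero
-- exactly when P has degree 3 or 4 and no repeated root over the algebraic
-- closure; it vanishes when a = b = 0.
27disc : Quartic → ℚ
27disc P = fromℕ 4 * invI P ^ 3 - invJ P ^ 2

record AffinePoint (P : Quartic) : Set where
  field
    x y     : ℚ
    onCurve : y ^ 2 ≡ eval P x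

-- On the smooth projective model Y² = a X⁴ + b X³ Z + ... + e Z⁴, with Y of
-- weight 2, the points with Z = 0 are given by Y² = a.
HasRationalPoint : Quartic → Set
HasRationalPoint P = AffinePoint P ⊎ (∃[ s ] s ^ 2 ≡ Quartic.a P)

record EllipticCurve : Set where
  field
    poly     : Quartic
    smooth   : 27disc poly ≢ 0ℚ
    hasPoint : HasRationalPoint poly

open EllipticCurve public

Point : EllipticCurve → Set
Point C = AffinePoint (poly C)

-- weierstrass A B is the equation  y² = x³ + A x + B.
record Weierstrass : Set where
  constructor weierstrass
  field
    A B : ℚ

-- Any y² = P(x) with a rational point is isomorphic over ℚ to its Jacobian
-- y² = x³ - 27 I x - 27 J.
toWeierstrass : EllipticCurve → Weierstrass
toWeierstrass C =
  weierstrass (- (fromℕ 27 * invI (poly C))) (- (fromℕ 27 * invJ (poly C)))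

-- Isomorphism over ℚ: for short Weierstrass equations the isomorphisms are
-- the substitutions (x , y) ↦ (u² x , u³ y) with u ∈ ℚ^×.
infix 4 _≅_
_≅_ : EllipticCurve → EllipticCurve → Set
C ≅ D = ∃[ u ] u ≢ 0ℚ × W′.A ≡ u ^ 4 * W.A × W′.B ≡ u ^ 6 * W.B
  where
  module W  = Weierstrass (toWeierstrass C)
  module W′ = Weierstrass (toWeierstrass D)

-- Elliptic curves are counted up to isomorphism over ℚ.  Counting equations
-- instead would allow a single curve to be rescaled to y² = λ² P(x).
InfinitelyMany : (EllipticCurve → Set) → Set
InfinitelyMany Q =
  Σ[ C ∈ (ℕ → EllipticCurve) ]
    (∀ n → Q (C n)) × (∀ m n → C m ≅ C n → m ≡ n)

-- C is given by y² = a x⁴ + b x² + c.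
IsBiquadratic : EllipticCurve → Set
IsBiquadratic C = ∃[ a ] ∃[ b ] ∃[ c ] poly C ≡ quartic a 0ℚ b 0ℚ c

IsXCoordinate : EllipticCurve → ℚ → Set
IsXCoordinate C x = ∃[ p ] AffinePoint.x {poly C} p ≡ x

IsConsecutiveSquares : ∀ C {n} → (Fin n → Point C) → Set
IsConsecutiveSquares C p =
  ∃[ u ] ∀ i → AffinePoint.x (p i) ≡ (u + fromℕ (suc (toℕ i))) ^ 2

HasConsecutiveSquares : ℕ → EllipticCurve → Set
HasConsecutiveSquares n C = ∃[ p ] IsConsecutiveSquares C {n} p

offsets : List ℚ
offsets = + 0 / 1 ∷ + 1 / 1 ∷ -[1+ 0 ] / 1 ∷ + 2 / 1 ∷ -[1+ 1 ] / 1 ∷ + 3 / 1 ∷ []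

{-# OPTIONS --safe #-}

-- Write X = x², so that the six prescribed values become distinct rationals
-- Xᵢ, and P(X) = ∏ (X - Xᵢ).  Following Mestre, but expanding at a finite point
-- s instead of at infinity, let N be a multiple of the cubic Taylor polynomial
-- of √P at s.  Then N² ≡ κ P modulo (X - s)⁴ for a constant κ, so that
-- N² - κ P = (X - s)⁴ R(X) with deg R ≤ 2, and R(Xᵢ) is a square for every i.
-- This gives the curve y² = R(x²) with parameter s.  As s tends to a nonzero
-- root X₀ = x₀² of P, the quadratic R degenerates to a multiple of (X - X₀)²
-- while its discriminant vanishes only to finite order: the j-invariant has a
-- pole at s = X₀, hence is not constant in s.  For s = x₀² + ε with ε ≠ 0 small
-- enough the curve is smooth and its j-invariant avoids any given finite list.

module Submission where

open import Defs
open import Data.Rational using (ℚ; _+_)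
open import Data.List using (map)
open import Data.List.Relation.Unary.All using (All)
open import Data.List.Relation.Unary.Unique.Propositional using (Unique)
open import Data.Product using (_×_)

open import Data.Fin using (Fin; zero; suc; toℕ)
open import Data.Integer as ℤ using (1ℤ)
open import Data.List using (List; []; _∷_)
open import Data.List.Membership.Propositional using (_∈_)
open import Data.List.Relation.Unary.All as All using ([]; _∷_)
import Data.List.Relation.Unary.All.Properties as All
open import Data.List.Relation.Unary.AllPairs using ([]; _∷_; allPairs?)
open import Data.List.Relation.Unary.Any using (here; there)
open import Data.Nat as ℕ using (ℕ; zero; suc)
import Data.Nat.Properties as ℕ
open import Data.Product using (_,_; ∃-syntax; map₂; proj₁; proj₂)
open import Data.Rational
open import Data.Rational.Properties
open import Data.Sum using (_⊎_; inj₁; inj₂)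
open import Data.Vec as Vec using (Vec; []; _∷_; head)
open import Data.Vec.Membership.Propositional using () renaming (_∈_ to _∈ᵛ_)
open import Data.Vec.Membership.Propositional.Properties using (∈-map⁺; ∈-lookup)
open import Data.Vec.Relation.Unary.All as VecAll using ([]; _∷_) renaming (All to VecAll)
import Data.Vec.Relation.Unary.All.Properties as VecAll
open import Data.Vec.Relation.Unary.Any using (here; there)
open import Function using (_∘_; _$_)
open import Level using (0ℓ)
open import Relation.Binary.Consequences using (dec⇒weaklyDec)
open import Relation.Binary.Definitions using (tri<; tri≈; tri>)
open import Relation.Binary.PropositionalEquality
  using (_≡_; _≢_; refl; sym; trans; cong; cong₂; subst; module ≡-Reasoning)
open import Relation.Nullary using (¬_; Dec; contradiction; yes; no)
open import Relation.Nullary.Decidable using (¬?; from-yes)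
open import Tactic.RingSolver using (solve-∀)
open import Tactic.RingSolver.Core.AlmostCommutativeRing using (AlmostCommutativeRing; fromCommutativeRing)

-- Arithmetic of the rationals.

ring : AlmostCommutativeRing 0ℓ 0ℓ
ring = fromCommutativeRing +-*-commutativeRing (dec⇒weaklyDec _≟_ 0ℚ)

p*q≢0 : ∀ {p q} → p ≢ 0ℚ → q ≢ 0ℚ → p * q ≢ 0ℚ
p*q≢0 {p} {q} p≢0 q≢0 pq≡0 = q≢0 $ begin
  q              ≡⟨ *-identityˡ q ⟨
  1ℚ * q         ≡⟨ cong (_* q) (*-inverseˡ p) ⟨
  1/ p * p * q   ≡⟨ *-assoc (1/ p) p q ⟩
  1/ p * (p * q) ≡⟨ cong (1/ p *_) pq≡0 ⟩
  1/ p * 0ℚ      ≡⟨ *-zeroʳ (1/ p) ⟩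
  0ℚ             ∎
  where
  open ≡-Reasoning
  instance _ = ≢-nonZero p≢0

p-q≡0⇒p≡q : ∀ {p q} → p - q ≡ 0ℚ → p ≡ q
p-q≡0⇒p≡q {p} {q} p-q≡0 = trans (identity p q) (trans (cong (_+ q) p-q≡0) (+-identityˡ q))
  where
  identity : ∀ p q → p ≡ p - q + q
  identity = solve-∀ ring

p≡q⇒p-q≡0 : ∀ {p q} → p ≡ q → p - q ≡ 0ℚ
p≡q⇒p-q≡0 {p} refl = +-inverseʳ p

-- Functions Lipschitz at 0 and their nonvanishing nearby.

-- Polynomial functions of ε enter only through being Lipschitz at 0, which is
-- closed under the ring operations and preserves nonvanishing near 0.
record Germ : Set where
  field
    at        : ℚ → ℚ
    bound     : ℚ
    0≤bound   : 0ℚ ≤ bound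
    lipschitz : ∀ {ε} → 0ℚ ≤ ε → ε ≤ 1ℚ → ∣ at ε - at 0ℚ ∣ ≤ bound * ε

open Germ

const : ℚ → Germ
const c = record
  { at        = λ _ → c
  ; bound     = 0ℚ
  ; 0≤bound   = ≤-refl
  ; lipschitz = λ {ε} _ _ → ≤-reflexive $ trans (cong ∣_∣ (+-inverseʳ c)) (sym (*-zeroˡ ε))
  }

var : Germ
var = record
  { at        = λ ε → ε
  ; bound     = 1ℚ
  ; 0≤bound   = nonNegative⁻¹ 1ℚ
  ; lipschitz = λ {ε} 0≤ε _ → ≤-reflexive $
      trans (cong ∣_∣ (+-identityʳ ε)) (trans (0≤p⇒∣p∣≡p 0≤ε) (sym (*-identityˡ ε)))
  }

infixl 6 _⊕_ _⊖_
infixl 7 _⊗_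

_⊕_ : Germ → Germ → Germ
f ⊕ g = record
  { at        = λ ε → at f ε + at g ε
  ; bound     = bound f + bound g
  ; 0≤bound   = +-mono-≤ (0≤bound f) (0≤bound g)
  ; lipschitz = λ {ε} 0≤ε ε≤1 → begin
      ∣ at f ε + at g ε - (at f 0ℚ + at g 0ℚ) ∣       ≡⟨ cong ∣_∣ (identity (at f ε) (at g ε) (at f 0ℚ) (at g 0ℚ)) ⟩
      ∣ (at f ε - at f 0ℚ) + (at g ε - at g 0ℚ) ∣     ≤⟨ ∣p+q∣≤∣p∣+∣q∣ (at f ε - at f 0ℚ) (at g ε - at g 0ℚ) ⟩
      ∣ at f ε - at f 0ℚ ∣ + ∣ at g ε - at g 0ℚ ∣     ≤⟨ +-mono-≤ (lipschitz f 0≤ε ε≤1) (lipschitz g 0≤ε ε≤1) ⟩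
      bound f * ε + bound g * ε                       ≡⟨ *-distribʳ-+ ε (bound f) (bound g) ⟨
      (bound f + bound g) * ε                         ∎
  }
  where
  open ≤-Reasoning
  identity : ∀ a b c d → a + b - (c + d) ≡ (a - c) + (b - d)
  identity = solve-∀ ring

-- The restriction `ε ≤ 1` turns the Lipschitz estimate into a uniform bound, which controls the
-- factor `at g ε` in the product rule behind `_⊗_`.
at-bounded : ∀ f {ε} → 0ℚ ≤ ε → ε ≤ 1ℚ → ∣ at f ε ∣ ≤ ∣ at f 0ℚ ∣ + bound f
at-bounded f {ε} 0≤ε ε≤1 = begin
  ∣ at f ε ∣                             ≡⟨ cong ∣_∣ (identity (at f ε) (at f 0ℚ)) ⟩
  ∣ at f 0ℚ + (at f ε - at f 0ℚ) ∣       ≤⟨ ∣p+q∣≤∣p∣+∣q∣ (at f 0ℚ) (at f ε - at f 0ℚ) ⟩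
  ∣ at f 0ℚ ∣ + ∣ at f ε - at f 0ℚ ∣     ≤⟨ +-monoʳ-≤ ∣ at f 0ℚ ∣ (lipschitz f 0≤ε ε≤1) ⟩
  ∣ at f 0ℚ ∣ + bound f * ε              ≤⟨ +-monoʳ-≤ ∣ at f 0ℚ ∣ (*-monoˡ-≤-nonNeg (bound f) ε≤1) ⟩
  ∣ at f 0ℚ ∣ + bound f * 1ℚ             ≡⟨ cong (∣ at f 0ℚ ∣ +_) (*-identityʳ (bound f)) ⟩
  ∣ at f 0ℚ ∣ + bound f                  ∎
  where
  open ≤-Reasoning
  instance _ = nonNegative (0≤bound f)
  identity : ∀ a b → a ≡ b + (a - b)
  identity = solve-∀ ring

*-mono-≤-nonNeg : ∀ {p q r s} → 0ℚ ≤ r → 0ℚ ≤ q → p ≤ q → r ≤ s → p * r ≤ q * s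
*-mono-≤-nonNeg {q = q} {r} 0≤r 0≤q p≤q r≤s =
  ≤-trans (*-monoʳ-≤-nonNeg r {{nonNegative 0≤r}} p≤q) (*-monoˡ-≤-nonNeg q {{nonNegative 0≤q}} r≤s)

0≤p*q : ∀ {p q} → 0ℚ ≤ p → 0ℚ ≤ q → 0ℚ ≤ p * q
0≤p*q 0≤p 0≤q = *-mono-≤-nonNeg ≤-refl 0≤p 0≤p 0≤q

_⊗_ : Germ → Germ → Germ
f ⊗ g = record
  { at        = λ ε → at f ε * at g ε
  ; bound     = bound f * M + ∣ at f 0ℚ ∣ * bound g
  ; 0≤bound   = +-mono-≤ (0≤p*q (0≤bound f) (+-mono-≤ (0≤∣p∣ (at g 0ℚ)) (0≤bound g)))
                         (0≤p*q (0≤∣p∣ (at f 0ℚ)) (0≤bound g))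
  ; lipschitz = λ {ε} 0≤ε ε≤1 → begin
      ∣ at f ε * at g ε - at f 0ℚ * at g 0ℚ ∣
        ≡⟨ cong ∣_∣ (identity (at f ε) (at g ε) (at f 0ℚ) (at g 0ℚ)) ⟩
      ∣ (at f ε - at f 0ℚ) * at g ε + at f 0ℚ * (at g ε - at g 0ℚ) ∣
        ≤⟨ ∣p+q∣≤∣p∣+∣q∣ ((at f ε - at f 0ℚ) * at g ε) (at f 0ℚ * (at g ε - at g 0ℚ)) ⟩
      ∣ (at f ε - at f 0ℚ) * at g ε ∣ + ∣ at f 0ℚ * (at g ε - at g 0ℚ) ∣
        ≡⟨ cong₂ _+_ (∣p*q∣≡∣p∣*∣q∣ (at f ε - at f 0ℚ) (at g ε)) (∣p*q∣≡∣p∣*∣q∣ (at f 0ℚ) (at g ε - at g 0ℚ)) ⟩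
      ∣ at f ε - at f 0ℚ ∣ * ∣ at g ε ∣ + ∣ at f 0ℚ ∣ * ∣ at g ε - at g 0ℚ ∣
        ≤⟨ +-mono-≤
             (*-mono-≤-nonNeg (0≤∣p∣ (at g ε)) (0≤p*q (0≤bound f) 0≤ε) (lipschitz f 0≤ε ε≤1) (at-bounded g 0≤ε ε≤1))
             (*-mono-≤-nonNeg (0≤∣p∣ (at g ε - at g 0ℚ)) (0≤∣p∣ (at f 0ℚ)) ≤-refl (lipschitz g 0≤ε ε≤1)) ⟩
      bound f * ε * M + ∣ at f 0ℚ ∣ * (bound g * ε)
        ≡⟨ regroup (bound f) ε M ∣ at f 0ℚ ∣ (bound g) ⟩
      (bound f * M + ∣ at f 0ℚ ∣ * bound g) * ε ∎
  }
  where
  open ≤-Reasoning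
  M = ∣ at g 0ℚ ∣ + bound g
  identity : ∀ a b c d → a * b - c * d ≡ (a - c) * b + c * (b - d)
  identity = solve-∀ ring
  regroup : ∀ a ε m c b → a * ε * m + c * (b * ε) ≡ (a * m + c * b) * ε
  regroup = solve-∀ ring

⊝_ : Germ → Germ
⊝ f = record
  { at        = λ ε → - at f ε
  ; bound     = bound f
  ; 0≤bound   = 0≤bound f
  ; lipschitz = λ {ε} 0≤ε ε≤1 → ≤-trans
      (≤-reflexive (trans (cong ∣_∣ (sym (neg-distrib-+ (at f ε) (- at f 0ℚ)))) (∣-p∣≡∣p∣ (at f ε - at f 0ℚ))))
      (lipschitz f 0≤ε ε≤1)
  }

_⊖_ : Germ → Germ → Germ
f ⊖ g = f ⊕ ⊝ g

-- The value at `ε` stays within `bound f * ε` of the value at 0, so any `ε` in (0, 1] with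
-- `bound f * ε` below `∣ at f 0ℚ ∣` works.
nonzero-nearby : ∀ f → at f 0ℚ ≢ 0ℚ → ∃[ ε ] ε ≢ 0ℚ × at f ε ≢ 0ℚ
nonzero-nearby f f0≢0 = ε , (λ ε≡0 → <-irrefl (sym ε≡0) 0<ε) , fε≢0
  where
  open ≤-Reasoning
  v = ∣ at f 0ℚ ∣
  -- `ε` will be `v / d`: `v ≤ d` gives `ε ≤ 1`, and `bound f < d` gives `bound f * ε < v`.
  d = bound f + v + 1ℚ
  0<v : 0ℚ < v
  0<v = ≰⇒> λ v≤0 → f0≢0 (∣p∣≡0⇒p≡0 (at f 0ℚ) (≤-antisym v≤0 (0≤∣p∣ (at f 0ℚ))))
  bound<d : bound f < d
  bound<d = begin-strict
    bound f            ≡⟨ +-identityʳ (bound f) ⟨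
    bound f + 0ℚ       <⟨ +-monoʳ-< (bound f) 0<v ⟩
    bound f + v        ≡⟨ +-identityʳ (bound f + v) ⟨
    bound f + v + 0ℚ   ≤⟨ +-monoʳ-≤ (bound f + v) (nonNegative⁻¹ 1ℚ) ⟩
    d                  ∎
  v≤d : v ≤ d
  v≤d = begin
    v                  ≡⟨ trans (+-identityʳ (0ℚ + v)) (+-identityˡ v) ⟨
    0ℚ + v + 0ℚ        ≤⟨ +-mono-≤ (+-monoˡ-≤ v (0≤bound f)) (nonNegative⁻¹ 1ℚ) ⟩
    d                  ∎
  instance
    v-pos : Positive v
    v-pos = positive 0<v
    d-pos : Positive d
    d-pos = positive (≤-<-trans (0≤bound f) bound<d)
    d-nonZero : NonZero d
    d-nonZero = pos⇒nonZero d
    i-pos : Positive (1/ d)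
    i-pos = 1/pos⇒pos d
  i = 1/ d
  ε = v * i
  0<ε : 0ℚ < ε
  0<ε = begin-strict
    0ℚ      ≡⟨ *-zeroʳ v ⟨
    v * 0ℚ  <⟨ *-monoʳ-<-pos v (positive⁻¹ i) ⟩
    v * i   ∎
  ε≤1 : ε ≤ 1ℚ
  ε≤1 = begin
    v * i  ≤⟨ *-monoʳ-≤-nonNeg i {{pos⇒nonNeg i}} v≤d ⟩
    d * i  ≡⟨ *-inverseʳ d ⟩
    1ℚ     ∎
  swap : ∀ m v i → m * (v * i) ≡ v * (m * i)
  swap = solve-∀ ring
  fε≢0 : at f ε ≢ 0ℚ
  fε≢0 fε≡0 = <-irrefl refl $ begin-strict
    v                       ≡⟨ ∣-p∣≡∣p∣ (at f 0ℚ) ⟨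
    ∣ - at f 0ℚ ∣           ≡⟨ cong ∣_∣ (+-identityˡ (- at f 0ℚ)) ⟨
    ∣ 0ℚ - at f 0ℚ ∣        ≡⟨ cong (λ z → ∣ z - at f 0ℚ ∣) fε≡0 ⟨
    ∣ at f ε - at f 0ℚ ∣    ≤⟨ lipschitz f (<⇒≤ 0<ε) ε≤1 ⟩
    bound f * ε             ≡⟨ swap (bound f) v i ⟩
    v * (bound f * i)       <⟨ *-monoʳ-<-pos v (*-monoˡ-<-pos i bound<d) ⟩
    v * (d * i)             ≡⟨ cong (v *_) (*-inverseʳ d) ⟩
    v * 1ℚ                  ≡⟨ *-identityʳ v ⟩
    v                       ∎

-- Germs are closed under products, so `nonzero-nearby` applied to the product of the list yields a
-- single `ε` for all its members.
common-nonzero-nearby : ∀ fs → All (λ f → at f 0ℚ ≢ 0ℚ) fs →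
                        ∃[ ε ] ε ≢ 0ℚ × All (λ f → at f ε ≢ 0ℚ) fs
common-nonzero-nearby fs fs0≢0 =
  let ε , ε≢0 , ∏≢0 = nonzero-nearby (∏ fs) (∏-nonzero fs0≢0) in ε , ε≢0 , factors-nonzero fs ∏≢0
  where
  ∏ : List Germ → Germ
  ∏ []       = const 1ℚ
  ∏ (f ∷ fs) = f ⊗ ∏ fs

  ∏-nonzero : ∀ {ε fs} → All (λ f → at f ε ≢ 0ℚ) fs → at (∏ fs) ε ≢ 0ℚ
  ∏-nonzero []         = λ ()
  ∏-nonzero (f≢0 ∷ ps) = p*q≢0 f≢0 (∏-nonzero ps)

  factors-nonzero : ∀ {ε} fs → at (∏ fs) ε ≢ 0ℚ → All (λ f → at f ε ≢ 0ℚ) fs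
  factors-nonzero []       _   = []
  factors-nonzero {ε} (f ∷ fs) ∏≢0 =
      (λ f≡0 → ∏≢0 (trans (cong (_* at (∏ fs) ε) f≡0) (*-zeroˡ (at (∏ fs) ε))))
    ∷ factors-nonzero fs (λ ∏≡0 → ∏≢0 (trans (cong (at f ε *_) ∏≡0) (*-zeroʳ (at f ε))))

-- Polynomials in h with germ coefficients, lowest degree first.

-- Multiplication by `w + h`: the argument `c` carries the previous coefficient, which the summand h
-- moves up by one degree.
mulLinear : ∀ {n} → Germ → Germ → Vec Germ n → Vec Germ (suc n)
mulLinear w c []       = c ∷ []
mulLinear w c (k ∷ ks) = (w ⊗ k ⊕ c) ∷ mulLinear w k ks

monic : ∀ {n} → Vec Germ n → Vec Germ (suc n)
monic []       = const 1ℚ ∷ []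
monic (w ∷ ws) = mulLinear w (const 0ℚ) (monic ws)

horner : ∀ {n} → Vec Germ n → ℚ → ℚ → ℚ
horner []       ε h = 0ℚ
horner (k ∷ ks) ε h = at k ε + h * horner ks ε h

horner-mulLinear : ∀ {n} w c (ks : Vec Germ n) ε h →
  horner (mulLinear w c ks) ε h ≡ at c ε + (at w ε + h) * horner ks ε h
horner-mulLinear w c [] ε h = identity (at c ε) (at w ε) h
  where
  identity : ∀ c w h → c + h * 0ℚ ≡ c + (w + h) * 0ℚ
  identity = solve-∀ ring
horner-mulLinear w c (k ∷ ks) ε h =
  trans (cong (λ z → at w ε * at k ε + at c ε + h * z) (horner-mulLinear w k ks ε h))
        (identity (at w ε) (at k ε) (at c ε) h (horner ks ε h))
  where
  identity : ∀ w k c h z → w * k + c + h * (k + (w + h) * z) ≡ c + (w + h) * (k + h * z)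
  identity = solve-∀ ring

horner-monic-root : ∀ {n ε h w} {ws : Vec Germ n} → w ∈ᵛ ws → at w ε + h ≡ 0ℚ → horner (monic ws) ε h ≡ 0ℚ
horner-monic-root {ε = ε} {h} {w} {v ∷ ws} w∈ws w+h≡0 = begin
  horner (monic (v ∷ ws)) ε h                 ≡⟨ horner-mulLinear v (const 0ℚ) (monic ws) ε h ⟩
  0ℚ + (at v ε + h) * horner (monic ws) ε h   ≡⟨ +-identityˡ _ ⟩
  (at v ε + h) * horner (monic ws) ε h        ≡⟨ product≡0 w∈ws ⟩
  0ℚ                                          ∎
  where
  open ≡-Reasoning
  product≡0 : w ∈ᵛ v ∷ ws → (at v ε + h) * horner (monic ws) ε h ≡ 0ℚ
  product≡0 (here refl)   = trans (cong (_* horner (monic ws) ε h) w+h≡0) (*-zeroˡ (horner (monic ws) ε h))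
  product≡0 (there w∈ws′) = trans (cong ((at v ε + h) *_) (horner-monic-root w∈ws′ w+h≡0)) (*-zeroʳ (at v ε + h))

-- The initial carry `const 0ℚ` makes the constant term of `monic ws` the product of the `w`.
head-monic≢0 : ∀ {n ε} {ws : Vec Germ n} → VecAll (λ w → at w ε ≢ 0ℚ) ws → at (head (monic ws)) ε ≢ 0ℚ
head-monic≢0 {ws = []}     []           = λ ()
head-monic≢0 {ε = ε} {ws = w ∷ ws} (w≢0 ∷ ws≢0) with monic ws | head-monic≢0 ws≢0
... | k ∷ _ | k≢0 = p*q≢0 w≢0 k≢0 ∘ trans (sym (+-identityʳ (at w ε * at k ε)))

-- Invariants of biquadratic quartics.

biquadratic : ℚ → ℚ → ℚ → Quartic
biquadratic a b c = quartic a 0ℚ b 0ℚ c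

invI-biquadratic : ∀ a b c → invI (biquadratic a b c) ≡ fromℕ 12 * a * c + b * b
invI-biquadratic = expanded
  where
  expanded : ∀ a b c → fromℕ 12 * a * c - fromℕ 3 * 0ℚ * 0ℚ + b * (b * 1ℚ) ≡ fromℕ 12 * a * c + b * b
  expanded = solve-∀ ring

invJ-biquadratic : ∀ a b c → invJ (biquadratic a b c) ≡ fromℕ 72 * a * b * c - fromℕ 2 * b * b * b
invJ-biquadratic = expanded
  where
  expanded : ∀ a b c →
      fromℕ 72 * a * b * c + fromℕ 9 * 0ℚ * b * 0ℚ
    - fromℕ 27 * a * (0ℚ * (0ℚ * 1ℚ)) - fromℕ 27 * c * (0ℚ * (0ℚ * 1ℚ)) - fromℕ 2 * (b * (b * (b * 1ℚ)))
    ≡ fromℕ 72 * a * b * c - fromℕ 2 * b * b * b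
  expanded = solve-∀ ring

-- The discriminant of a x⁴ + b x² + c is 16 a c Δ²: a repeated root arises when the quadratic in x²
-- has one, or when one of its roots is 0 or ∞. The factor 432 is 27 · 16.
27disc-biquadratic : ∀ a b c → let Δ = b * b - fromℕ 4 * a * c in
  27disc (biquadratic a b c) ≡ fromℕ 432 * (a * c * (Δ * Δ))
27disc-biquadratic a b c = trans
  (cong₂ (λ I J → fromℕ 4 * I ^ 3 - J ^ 2) (invI-biquadratic a b c) (invJ-biquadratic a b c))
  (expanded a b c)
  where
  expanded : ∀ a b c →
    let I = fromℕ 12 * a * c + b * b
        J = fromℕ 72 * a * b * c - fromℕ 2 * b * b * b
        Δ = b * b - fromℕ 4 * a * c
    in fromℕ 4 * (I * (I * (I * 1ℚ))) - J * (J * 1ℚ) ≡ fromℕ 432 * (a * c * (Δ * Δ))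
  expanded = solve-∀ ring

27disc-biquadratic≢0 : ∀ {a b c} → a ≢ 0ℚ → c ≢ 0ℚ → b * b - fromℕ 4 * a * c ≢ 0ℚ →
  27disc (biquadratic a b c) ≢ 0ℚ
27disc-biquadratic≢0 {a} {b} {c} a≢0 c≢0 Δ≢0 =
  p*q≢0 {fromℕ 432} (λ ()) (p*q≢0 (p*q≢0 a≢0 c≢0) (p*q≢0 Δ≢0 Δ≢0)) ∘ trans (sym (27disc-biquadratic a b c))

-- The j-invariant, and infinitely many isomorphism classes.

-- Equality of the j-invariants I³ / (4 I³ - J²), cleared of denominators.
SameJ : EllipticCurve → EllipticCurve → Set
SameJ C D = invI (poly C) * invI (poly C) * invI (poly C) * (invJ (poly D) * invJ (poly D))
          ≡ invI (poly D) * invI (poly D) * invI (poly D) * (invJ (poly C) * invJ (poly C))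

-- An isomorphism multiplies I by u⁴ and J by u⁶, so both sides of `SameJ` equal u¹² I³ J².
≅⇒SameJ : ∀ C D → C ≅ D → SameJ C D
≅⇒SameJ C D (u , _ , A′≡u⁴A , B′≡u⁶B) = trans
  (cong (λ J → I * I * I * (J * J)) J′≡u⁶J)
  (trans (identity (u ^ 2) I J) (cong (λ I → I * I * I * (J * J)) (sym I′≡u⁴I)))
  where
  I  = invI (poly C)
  J  = invJ (poly C)
  I′ = invI (poly D)
  J′ = invJ (poly D)
  unscale : ∀ z → z ≡ - (1ℤ / 27) * - (fromℕ 27 * z)
  unscale = solve-∀ ring
  rescale : ∀ v z → - (1ℤ / 27) * (v * - (fromℕ 27 * z)) ≡ v * z
  rescale = solve-∀ ring
  cancel : ∀ v z {z′} → - (fromℕ 27 * z′) ≡ v * - (fromℕ 27 * z) → z′ ≡ v * z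
  cancel v z {z′} eq = trans (unscale z′) (trans (cong (- (1ℤ / 27) *_) eq) (rescale v z))
  square : ∀ u → u * (u * (u * (u * 1ℚ))) ≡ u * (u * 1ℚ) * (u * (u * 1ℚ))
  square = solve-∀ ring
  cube : ∀ u → u * (u * (u * (u * (u * (u * 1ℚ))))) ≡ u * (u * 1ℚ) * (u * (u * 1ℚ)) * (u * (u * 1ℚ))
  cube = solve-∀ ring
  I′≡u⁴I : I′ ≡ u ^ 2 * u ^ 2 * I
  I′≡u⁴I = cancel (u ^ 2 * u ^ 2) I (trans A′≡u⁴A (cong (_* - (fromℕ 27 * I)) (square u)))
  J′≡u⁶J : J′ ≡ u ^ 2 * u ^ 2 * u ^ 2 * J
  J′≡u⁶J = cancel (u ^ 2 * u ^ 2 * u ^ 2) J (trans B′≡u⁶B (cong (_* - (fromℕ 27 * J)) (cube u)))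
  identity : ∀ v I J → I * I * I * (v * v * v * J * (v * v * v * J)) ≡ v * v * I * (v * v * I) * (v * v * I) * (J * J)
  identity = solve-∀ ring

-- Each term is chosen with j-invariant different from those of all earlier terms; since isomorphic
-- curves share their j-invariant, no two terms are isomorphic.
infinitelyMany : ∀ {Q : EllipticCurve → Set} →
  (∀ Ds → ∃[ C ] Q C × All (λ D → ¬ SameJ D C) Ds) → InfinitelyMany Q
infinitelyMany {Q} new = curve , (λ n → proj₁ (proj₂ (new (earlier n)))) , injective
  where
  earlier : ℕ → List EllipticCurve
  earlier zero    = []
  earlier (suc n) = proj₁ (new (earlier n)) ∷ earlier n

  curve : ℕ → EllipticCurve
  curve n = proj₁ (new (earlier n))

  curve∈earlier : ∀ {m n} → m ℕ.<′ n → curve m ∈ earlier n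
  curve∈earlier (ℕ.<′-base)      = here refl
  curve∈earlier (ℕ.<′-step m<n)  = there (curve∈earlier m<n)

  distinct : ∀ {m n} → m ℕ.< n → ¬ SameJ (curve m) (curve n)
  distinct {n = n} m<n = All.lookup (proj₂ (proj₂ (new (earlier n)))) (curve∈earlier (ℕ.<⇒<′ m<n))

  injective : ∀ m n → curve m ≅ curve n → m ≡ n
  injective m n m≅n with ℕ.<-cmp m n
  ... | tri< m<n _ _ = contradiction (≅⇒SameJ (curve m) (curve n) m≅n) (distinct m<n)
  ... | tri≈ _ m≡n _ = m≡n
  ... | tri> _ _ n<m = contradiction (sym (≅⇒SameJ (curve m) (curve n) m≅n)) (distinct n<m)

-- The one-parameter family and its degeneration at ε = 0.

-- With s = x₀² + ε and h = X - s, the polynomial P is (ε + h) ∑ kᵢ hⁱ.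
module Family
  (x₀ : ℚ) (x₀≢0 : x₀ ≢ 0ℚ)
  (k₀ k₁ k₂ k₃ k₄ k₅ : Germ) (k₀≢0 : at k₀ 0ℚ ≢ 0ℚ)
  where

  # : ℕ → Germ
  # n = const (fromℕ n)

  p₀ p₁ p₂ p₃ p₄ p₅ p₆ g₂ g₃ r₀ r₁ r₂ s a b c i j : Germ
  p₀ = var ⊗ k₀
  p₁ = k₀ ⊕ var ⊗ k₁
  p₂ = k₁ ⊕ var ⊗ k₂
  p₃ = k₂ ⊕ var ⊗ k₃
  p₄ = k₃ ⊕ var ⊗ k₄
  p₅ = k₄ ⊕ var ⊗ k₅
  p₆ = k₅

  -- 16 p₀³ √(P / p₀) = 16 p₀³ + 8 p₀² p₁ h + 2 p₀ g₂ h² + g₃ h³ + O(h⁴), and the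
  -- quadratic in the header is R = r₂ h² + p₀ r₁ h + p₀² r₀.
  g₂ = # 4 ⊗ p₀ ⊗ p₂ ⊖ p₁ ⊗ p₁
  g₃ = # 8 ⊗ (p₀ ⊗ p₀) ⊗ p₃ ⊖ p₁ ⊗ g₂
  r₂ = g₃ ⊗ g₃ ⊖ # 256 ⊗ (p₀ ⊗ p₀ ⊗ p₀ ⊗ p₀ ⊗ p₀) ⊗ p₆
  r₁ = # 4 ⊗ g₂ ⊗ g₃ ⊖ # 256 ⊗ (p₀ ⊗ p₀ ⊗ p₀ ⊗ p₀) ⊗ p₅
  r₀ = # 4 ⊗ (g₂ ⊗ g₂) ⊕ # 16 ⊗ p₁ ⊗ g₃ ⊖ # 256 ⊗ (p₀ ⊗ p₀ ⊗ p₀) ⊗ p₄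

  s = const (x₀ * x₀) ⊕ var
  a = r₂
  b = p₀ ⊗ r₁ ⊖ # 2 ⊗ s ⊗ r₂
  c = p₀ ⊗ p₀ ⊗ r₀ ⊖ s ⊗ (p₀ ⊗ r₁) ⊕ s ⊗ s ⊗ r₂

  -- b² - 4 a c = p₀² δ vanishes at ε = 0, but δ does not.
  δ : Germ
  δ = r₁ ⊗ r₁ ⊖ # 4 ⊗ r₀ ⊗ r₂

  i = # 12 ⊗ a ⊗ c ⊕ b ⊗ b
  j = # 72 ⊗ a ⊗ b ⊗ c ⊖ # 2 ⊗ b ⊗ b ⊗ b

  -- Vanishes where the curve at ε has the j-invariant of D.
  separator : EllipticCurve → Germ
  separator D = const (I * I * I) ⊗ (j ⊗ j) ⊖ i ⊗ i ⊗ i ⊗ const (J * J)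
    where
    I = invI (poly D)
    J = invJ (poly D)

  -- `N` is 16 p₀³ times the cubic Taylor polynomial of √(P / p₀), so `N * N` and 256 p₀⁵ P agree
  -- below h⁴. The quadratic factor collects what remains in degrees 4, 5 and 6.
  expansion : ∀ p₀ p₁ p₂ p₃ p₄ p₅ p₆ h →
    let g₂ = fromℕ 4 * p₀ * p₂ - p₁ * p₁
        g₃ = fromℕ 8 * (p₀ * p₀) * p₃ - p₁ * g₂
        r₂ = g₃ * g₃ - fromℕ 256 * (p₀ * p₀ * p₀ * p₀ * p₀) * p₆
        r₁ = fromℕ 4 * g₂ * g₃ - fromℕ 256 * (p₀ * p₀ * p₀ * p₀) * p₅
        r₀ = fromℕ 4 * (g₂ * g₂) + fromℕ 16 * p₁ * g₃ - fromℕ 256 * (p₀ * p₀ * p₀) * p₄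
        N  = fromℕ 16 * (p₀ * p₀ * p₀) + fromℕ 8 * (p₀ * p₀) * p₁ * h + fromℕ 2 * p₀ * g₂ * (h * h) + g₃ * (h * h * h)
        P  = p₀ + h * (p₁ + h * (p₂ + h * (p₃ + h * (p₄ + h * (p₅ + h * p₆)))))
    in N * N ≡ h * h * (h * h) * (r₂ * (h * h) + p₀ * r₁ * h + p₀ * p₀ * r₀) + fromℕ 256 * (p₀ * p₀ * p₀ * p₀ * p₀) * P
  expansion = solve-∀ ring

  -- At ε = 0 one has p₀ = 0 and p₁ = k₀, hence g₂ = -k₀² and g₃ = k₀³, and only g₃² survives.
  r₂-at-0 : at r₂ 0ℚ ≡ let k = at k₀ 0ℚ in k * k * k * (k * k * k)
  r₂-at-0 = identity (at k₀ 0ℚ) (at k₁ 0ℚ) (at k₂ 0ℚ) (at k₃ 0ℚ) (at k₅ 0ℚ)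
    where
    identity : ∀ k₀ k₁ k₂ k₃ k₅ →
      let p₀ = 0ℚ * k₀
          p₁ = k₀ + 0ℚ * k₁
          g₂ = fromℕ 4 * p₀ * (k₁ + 0ℚ * k₂) - p₁ * p₁
          g₃ = fromℕ 8 * (p₀ * p₀) * (k₂ + 0ℚ * k₃) - p₁ * g₂
      in g₃ * g₃ - fromℕ 256 * (p₀ * p₀ * p₀ * p₀ * p₀) * k₅ ≡ k₀ * k₀ * k₀ * (k₀ * k₀ * k₀)
    identity = solve-∀ ring

  -- With the same values r₁ = -4 k₀⁵ and r₀ = 20 k₀⁴, so δ = 16 k₀¹⁰ - 80 k₀¹⁰.
  δ-at-0 : at δ 0ℚ ≡ let k = at k₀ 0ℚ in - fromℕ 64 * (k * k * k * (k * k) * (k * k * k * (k * k)))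
  δ-at-0 = identity (at k₀ 0ℚ) (at k₁ 0ℚ) (at k₂ 0ℚ) (at k₃ 0ℚ) (at k₄ 0ℚ) (at k₅ 0ℚ)
    where
    identity : ∀ k₀ k₁ k₂ k₃ k₄ k₅ →
      let p₀ = 0ℚ * k₀
          p₁ = k₀ + 0ℚ * k₁
          g₂ = fromℕ 4 * p₀ * (k₁ + 0ℚ * k₂) - p₁ * p₁
          g₃ = fromℕ 8 * (p₀ * p₀) * (k₂ + 0ℚ * k₃) - p₁ * g₂
          r₂ = g₃ * g₃ - fromℕ 256 * (p₀ * p₀ * p₀ * p₀ * p₀) * k₅
          r₁ = fromℕ 4 * g₂ * g₃ - fromℕ 256 * (p₀ * p₀ * p₀ * p₀) * (k₄ + 0ℚ * k₅)
          r₀ = fromℕ 4 * (g₂ * g₂) + fromℕ 16 * p₁ * g₃ - fromℕ 256 * (p₀ * p₀ * p₀) * (k₃ + 0ℚ * k₄)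
      in r₁ * r₁ - fromℕ 4 * r₀ * r₂ ≡ - fromℕ 64 * (k₀ * k₀ * k₀ * (k₀ * k₀) * (k₀ * k₀ * k₀ * (k₀ * k₀)))
    identity = solve-∀ ring

  c-at-0 : at c 0ℚ ≡ x₀ * x₀ * (x₀ * x₀) * at r₂ 0ℚ
  c-at-0 = identity (at k₀ 0ℚ) (at r₀ 0ℚ) (at r₁ 0ℚ) (at r₂ 0ℚ) (x₀ * x₀)
    where
    identity : ∀ k r₀ r₁ r₂ e →
      0ℚ * k * (0ℚ * k) * r₀ - (e + 0ℚ) * (0ℚ * k * r₁) + (e + 0ℚ) * (e + 0ℚ) * r₂ ≡ e * e * r₂
    identity = solve-∀ ring

  -- At ε = 0 the quadratic is a (X - x₀²)², so with m = x₀² a one finds i = 16 m² and j = -128 m³.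
  -- Thus 4 i³ = j², which is the pole of the j-invariant, and the discriminant of `D` factors out.
  separator-at-0 : ∀ D → let m = x₀ * x₀ * at r₂ 0ℚ in
    at (separator D) 0ℚ ≡ fromℕ 4096 * (m * m * m * (m * m * m)) * 27disc (poly D)
  separator-at-0 D = identity (at k₀ 0ℚ) (at r₀ 0ℚ) (at r₁ 0ℚ) (at r₂ 0ℚ) (x₀ * x₀) (invI (poly D)) (invJ (poly D))
    where
    identity : ∀ k r₀ r₁ a e I J →
      let p₀ = 0ℚ * k
          s = e + 0ℚ
          b = p₀ * r₁ - fromℕ 2 * s * a
          c = p₀ * p₀ * r₀ - s * (p₀ * r₁) + s * s * a
          i = fromℕ 12 * a * c + b * b
          j = fromℕ 72 * a * b * c - fromℕ 2 * b * b * b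
          m = e * a
      in I * I * I * (j * j) - i * i * i * (J * J)
         ≡ fromℕ 4096 * (m * m * m * (m * m * m)) * (fromℕ 4 * (I * (I * (I * 1ℚ))) - J * (J * 1ℚ))
    identity = solve-∀ ring

  -- Substituting h = X - s leaves the discriminant of a quadratic unchanged, and in h the
  -- coefficients are r₂, p₀ r₁ and p₀² r₀.
  Δ≡p₀²δ : ∀ ε → at b ε * at b ε - fromℕ 4 * at a ε * at c ε ≡ at p₀ ε * at p₀ ε * at δ ε
  Δ≡p₀²δ ε = identity (at p₀ ε) (at r₀ ε) (at r₁ ε) (at r₂ ε) (at s ε)
    where
    identity : ∀ p₀ r₀ r₁ r₂ s →
      let b = p₀ * r₁ - fromℕ 2 * s * r₂
          c = p₀ * p₀ * r₀ - s * (p₀ * r₁) + s * s * r₂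
      in b * b - fromℕ 4 * r₂ * c ≡ p₀ * p₀ * (r₁ * r₁ - fromℕ 4 * r₀ * r₂)
    identity = solve-∀ ring

  quintic : ℚ → ℚ → ℚ
  quintic = horner (k₀ ∷ k₁ ∷ k₂ ∷ k₃ ∷ k₄ ∷ k₅ ∷ [])

  -- Here `y` is an abscissa of the curve, X = y², and the second hypothesis is P(X) = 0 in factored
  -- form. Then `expansion` reduces to N² = h⁴ R, and z = N / h² is a square root of R.
  point : ∀ ε y → let h = y * y - at s ε in
    h ≢ 0ℚ → (ε + h) * quintic ε h ≡ 0ℚ →
    ∃[ z ] z ^ 2 ≡ eval (biquadratic (at a ε) (at b ε) (at c ε)) y
  point ε y h≢0 root = z , z²≡eval
    where
    open ≡-Reasoning
    h = y * y - at s ε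
    instance _ = ≢-nonZero h≢0
    v = 1/ h
    q₀ = at p₀ ε
    N = fromℕ 16 * (q₀ * q₀ * q₀) + fromℕ 8 * (q₀ * q₀) * at p₁ ε * h + fromℕ 2 * q₀ * at g₂ ε * (h * h) + at g₃ ε * (h * h * h)
    R = at r₂ ε * (h * h) + q₀ * at r₁ ε * h + q₀ * q₀ * at r₀ ε
    P = q₀ + h * (at p₁ ε + h * (at p₂ ε + h * (at p₃ ε + h * (at p₄ ε + h * (at p₅ ε + h * at p₆ ε)))))
    z = N * (v * v)

    factor : ∀ ε h k₀ k₁ k₂ k₃ k₄ k₅ →
      ε * k₀ + h * (k₀ + ε * k₁ + h * (k₁ + ε * k₂ + h * (k₂ + ε * k₃ + h * (k₃ + ε * k₄ + h * (k₄ + ε * k₅ + h * k₅)))))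
      ≡ (ε + h) * (k₀ + h * (k₁ + h * (k₂ + h * (k₃ + h * (k₄ + h * (k₅ + h * 0ℚ))))))
    factor = solve-∀ ring

    P≡0 : P ≡ 0ℚ
    P≡0 = trans (factor ε h (at k₀ ε) (at k₁ ε) (at k₂ ε) (at k₃ ε) (at k₄ ε) (at k₅ ε)) root

    N²≡h⁴R : N * N ≡ h * h * (h * h) * R
    N²≡h⁴R = begin
      N * N
        ≡⟨ expansion q₀ (at p₁ ε) (at p₂ ε) (at p₃ ε) (at p₄ ε) (at p₅ ε) (at p₆ ε) h ⟩
      h * h * (h * h) * R + fromℕ 256 * (q₀ * q₀ * q₀ * q₀ * q₀) * P
        ≡⟨ cong (λ z → h * h * (h * h) * R + fromℕ 256 * (q₀ * q₀ * q₀ * q₀ * q₀) * z) P≡0 ⟩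
      h * h * (h * h) * R + fromℕ 256 * (q₀ * q₀ * q₀ * q₀ * q₀) * 0ℚ
        ≡⟨ cong (h * h * (h * h) * R +_) (*-zeroʳ (fromℕ 256 * (q₀ * q₀ * q₀ * q₀ * q₀))) ⟩
      h * h * (h * h) * R + 0ℚ
        ≡⟨ +-identityʳ (h * h * (h * h) * R) ⟩
      h * h * (h * h) * R ∎

    shift : ∀ p₀ r₀ r₁ r₂ s y → let h = y * y - s in
      r₂ * (h * h) + p₀ * r₁ * h + p₀ * p₀ * r₀
      ≡ r₂ * (y * (y * (y * (y * 1ℚ)))) + 0ℚ * (y * (y * (y * 1ℚ))) + (p₀ * r₁ - fromℕ 2 * s * r₂) * (y * (y * 1ℚ))
        + 0ℚ * y + (p₀ * p₀ * r₀ - s * (p₀ * r₁) + s * s * r₂)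
    shift = solve-∀ ring

    regroup : ∀ N v → N * (v * v) * (N * (v * v) * 1ℚ) ≡ N * N * (v * v * (v * v))
    regroup = solve-∀ ring

    regroup′ : ∀ h R v → h * h * (h * h) * R * (v * v * (v * v)) ≡ h * v * (h * v) * (h * v * (h * v)) * R
    regroup′ = solve-∀ ring

    z²≡eval : z ^ 2 ≡ eval (biquadratic (at a ε) (at b ε) (at c ε)) y
    z²≡eval = begin
      z ^ 2                                          ≡⟨ regroup N v ⟩
      N * N * (v * v * (v * v))                      ≡⟨ cong (_* (v * v * (v * v))) N²≡h⁴R ⟩
      h * h * (h * h) * R * (v * v * (v * v))        ≡⟨ regroup′ h R v ⟩
      h * v * (h * v) * (h * v * (h * v)) * R        ≡⟨ cong (λ u → u * u * (u * u) * R) (*-inverseʳ h) ⟩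
      1ℚ * R                                         ≡⟨ *-identityˡ R ⟩
      R                                              ≡⟨ shift q₀ (at r₀ ε) (at r₁ ε) (at r₂ ε) (at s ε) y ⟩
      eval (biquadratic (at a ε) (at b ε) (at c ε)) y ∎

  r₂-at-0≢0 : at r₂ 0ℚ ≢ 0ℚ
  r₂-at-0≢0 = p*q≢0 k³≢0 k³≢0 ∘ trans (sym r₂-at-0)
    where k³≢0 = p*q≢0 (p*q≢0 k₀≢0 k₀≢0) k₀≢0

  δ-at-0≢0 : at δ 0ℚ ≢ 0ℚ
  δ-at-0≢0 = p*q≢0 { - fromℕ 64} (λ ()) (p*q≢0 k⁵≢0 k⁵≢0) ∘ trans (sym δ-at-0)
    where k⁵≢0 = p*q≢0 (p*q≢0 (p*q≢0 k₀≢0 k₀≢0) k₀≢0) (p*q≢0 k₀≢0 k₀≢0)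

  c-at-0≢0 : at c 0ℚ ≢ 0ℚ
  c-at-0≢0 = p*q≢0 (p*q≢0 (p*q≢0 x₀≢0 x₀≢0) (p*q≢0 x₀≢0 x₀≢0)) r₂-at-0≢0 ∘ trans (sym c-at-0)

  separator-at-0≢0 : ∀ D → at (separator D) 0ℚ ≢ 0ℚ
  separator-at-0≢0 D =
    p*q≢0 (p*q≢0 {fromℕ 4096} (λ ()) (p*q≢0 m³≢0 m³≢0)) (smooth D) ∘ trans (sym (separator-at-0 D))
    where
    m≢0 = p*q≢0 (p*q≢0 x₀≢0 x₀≢0) r₂-at-0≢0
    m³≢0 = p*q≢0 (p*q≢0 m≢0 m≢0) m≢0

  -- The root condition on `y` is uniform in `ε` because `ε` is chosen only afterwards, depending on
  -- `Ds`.
  new : ∀ Ds → ∃[ C ] IsBiquadratic C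
    × (∀ y → y * y ≡ x₀ * x₀ ⊎ (∀ ε → quintic ε (y * y - at s ε) ≡ 0ℚ) → IsXCoordinate C y)
    × All (λ D → ¬ SameJ D C) Ds
  -- `k₀` together with `ε ≢ 0ℚ` keeps s off the roots of P; `a`, `c` and `δ` then give smoothness,
  -- and the separators exclude the j-invariants of `Ds`.
  new Ds = build (common-nonzero-nearby (k₀ ∷ a ∷ c ∷ δ ∷ map separator Ds)
    (k₀≢0 ∷ r₂-at-0≢0 ∷ c-at-0≢0 ∷ δ-at-0≢0 ∷ All.map⁺ (All.universal separator-at-0≢0 Ds)))
    where
    build : ∃[ ε ] ε ≢ 0ℚ × All (λ f → at f ε ≢ 0ℚ) (k₀ ∷ a ∷ c ∷ δ ∷ map separator Ds) → _
    build (ε , ε≢0 , k≢0 ∷ a≢0 ∷ c≢0 ∷ δ≢0 ∷ separated) =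
      C , (at a ε , at b ε , at c ε , refl) , isXCoordinate , All.map (λ {D} → ¬sameJ D) (All.map⁻ separated)
      where
      xPoint : ∀ y → y * y ≡ x₀ * x₀ ⊎ (∀ ε → quintic ε (y * y - at s ε) ≡ 0ℚ) →
        ∃[ z ] z ^ 2 ≡ eval (biquadratic (at a ε) (at b ε) (at c ε)) y
      -- For X = x₀² one has h = -ε, so the linear factor ε + h of P vanishes while h does not.
      xPoint y (inj₁ y²≡x₀²) = point ε y (ε≢0 ∘ h≡0⇒ε≡0) ε+h≡0
        where
        h≡-ε : y * y - at s ε ≡ - ε
        h≡-ε = trans (cong (_- at s ε) y²≡x₀²) (identity (x₀ * x₀) ε)
          where
          identity : ∀ e ε → e - (e + ε) ≡ - ε
          identity = solve-∀ ring
        h≡0⇒ε≡0 : y * y - at s ε ≡ 0ℚ → ε ≡ 0ℚ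
        h≡0⇒ε≡0 h≡0 = neg-injective (trans (sym h≡-ε) h≡0)
        ε+h≡0 : (ε + (y * y - at s ε)) * quintic ε (y * y - at s ε) ≡ 0ℚ
        ε+h≡0 = trans (cong (λ z → (ε + z) * quintic ε (y * y - at s ε)) h≡-ε)
          (trans (cong (_* quintic ε (y * y - at s ε)) (+-inverseʳ ε)) (*-zeroˡ (quintic ε (y * y - at s ε))))
      xPoint y (inj₂ root) = point ε y h≢0
        (trans (cong ((ε + (y * y - at s ε)) *_) (root ε)) (*-zeroʳ (ε + (y * y - at s ε))))
        where
        -- The quintic has constant term `k₀`, nonzero at `ε`, so h = 0 is not one of its roots.
        quintic-at-0 : ∀ h → h ≡ 0ℚ → quintic ε h ≡ at k₀ ε
        quintic-at-0 h refl = trans (cong (at k₀ ε +_) (*-zeroˡ (horner (k₁ ∷ k₂ ∷ k₃ ∷ k₄ ∷ k₅ ∷ []) ε 0ℚ))) (+-identityʳ (at k₀ ε))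
        h≢0 : y * y - at s ε ≢ 0ℚ
        h≢0 h≡0 = k≢0 (trans (sym (quintic-at-0 _ h≡0)) (root ε))

      C : EllipticCurve
      C = record
        { poly     = biquadratic (at a ε) (at b ε) (at c ε)
        ; smooth   = 27disc-biquadratic≢0 a≢0 c≢0
            (p*q≢0 (p*q≢0 p₀≢0 p₀≢0) δ≢0 ∘ trans (sym (Δ≡p₀²δ ε)))
        ; hasPoint = let z , z²≡eval = xPoint x₀ (inj₁ refl)
                     in inj₁ record { x = x₀ ; y = z ; onCurve = z²≡eval }
        }
        where p₀≢0 = p*q≢0 ε≢0 k≢0

      isXCoordinate : ∀ y → y * y ≡ x₀ * x₀ ⊎ (∀ ε → quintic ε (y * y - at s ε) ≡ 0ℚ) → IsXCoordinate C y
      isXCoordinate y y-root = let z , z²≡eval = xPoint y y-root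
        in record { x = y ; y = z ; onCurve = z²≡eval } , refl

      ¬sameJ : ∀ D → at (separator D) ε ≢ 0ℚ → ¬ SameJ D C
      ¬sameJ D separator≢0 same = separator≢0 (trans
        (cong₂ (λ i j → I * I * I * (j * j) - i * i * i * (J * J))
          (sym (invI-biquadratic (at a ε) (at b ε) (at c ε))) (sym (invJ-biquadratic (at a ε) (at b ε) (at c ε))))
        (p≡q⇒p-q≡0 same))
        where
        I = invI (poly D)
        J = invJ (poly D)

-- From six prescribed x-coordinates to the family.

-- The prescribed x-coordinates are squares, hence nonnegative, so the roots of P, which are their
-- squares, stay distinct: a zero sum would force both numbers to be 0.
p≢q⇒p*p-q*q≢0 : ∀ {p q} → p ≢ q → 0ℚ ≤ p → 0ℚ ≤ q → p * p - q * q ≢ 0ℚ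
p≢q⇒p*p-q*q≢0 {p} {q} p≢q 0≤p 0≤q =
  p*q≢0 (p≢q ∘ p-q≡0⇒p≡q) p+q≢0 ∘ trans (sym (identity p q))
  where
  identity : ∀ p q → p * p - q * q ≡ (p - q) * (p + q)
  identity = solve-∀ ring
  p+q≢0 : p + q ≢ 0ℚ
  p+q≢0 p+q≡0 = p≢q (trans (vanish 0≤p p≤0) (sym (vanish 0≤q q≤0)))
    where
    open ≤-Reasoning
    vanish : ∀ {z} → 0ℚ ≤ z → z ≤ 0ℚ → z ≡ 0ℚ
    vanish 0≤z z≤0 = ≤-antisym z≤0 0≤z
    p≤0 : p ≤ 0ℚ
    p≤0 = begin p ≡⟨ +-identityʳ p ⟨ p + 0ℚ ≤⟨ +-monoʳ-≤ p 0≤q ⟩ p + q ≡⟨ p+q≡0 ⟩ 0ℚ ∎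
    q≤0 : q ≤ 0ℚ
    q≤0 = begin q ≡⟨ +-identityˡ q ⟨ 0ℚ + q ≤⟨ +-monoˡ-≤ q 0≤p ⟩ p + q ≡⟨ p+q≡0 ⟩ 0ℚ ∎

0≤p^2 : ∀ p → 0ℚ ≤ p ^ 2
0≤p^2 p = subst (0ℚ ≤_) (sym p^2≡∣p∣*∣p∣) (0≤p*q (0≤∣p∣ p) (0≤∣p∣ p))
  where
  square : ∀ p → p * (p * 1ℚ) ≡ p * p
  square = solve-∀ ring
  square-neg : ∀ p → p * (p * 1ℚ) ≡ - p * - p
  square-neg = solve-∀ ring
  p^2≡∣p∣*∣p∣ : p ^ 2 ≡ ∣ p ∣ * ∣ p ∣
  p^2≡∣p∣*∣p∣ with ∣p∣≡p∨∣p∣≡-p p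
  ... | inj₁ ∣p∣≡p  = trans (square p) (sym (cong₂ _*_ ∣p∣≡p ∣p∣≡p))
  ... | inj₂ ∣p∣≡-p = trans (square-neg p) (sym (cong₂ _*_ ∣p∣≡-p ∣p∣≡-p))

newCurve-quintic : ∀ x₀ → x₀ ≢ 0ℚ → (ks : Vec Germ 6) → at (head ks) 0ℚ ≢ 0ℚ →
  ∀ Ds → ∃[ C ] IsBiquadratic C
    × (∀ y → y * y ≡ x₀ * x₀ ⊎ (∀ ε → horner ks ε (y * y - (x₀ * x₀ + ε)) ≡ 0ℚ) → IsXCoordinate C y)
    × All (λ D → ¬ SameJ D C) Ds
newCurve-quintic x₀ x₀≢0 (k₀ ∷ k₁ ∷ k₂ ∷ k₃ ∷ k₄ ∷ k₅ ∷ []) = Family.new x₀ x₀≢0 k₀ k₁ k₂ k₃ k₄ k₅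

-- The distinctness makes x₀² a simple root of P: at ε = 0 the quintic has constant term equal to
-- the product of the x₀² - y².
newCurve : ∀ x₀ (ys : Vec ℚ 5) → x₀ ≢ 0ℚ → VecAll (λ y → x₀ * x₀ - y * y ≢ 0ℚ) ys →
  ∀ Ds → ∃[ C ] (IsBiquadratic C × VecAll (IsXCoordinate C) (x₀ ∷ ys)) × All (λ D → ¬ SameJ D C) Ds
newCurve x₀ ys x₀≢0 distinct Ds =
  let C , isBiquadratic , isXCoordinate , new = newCurve-quintic x₀ x₀≢0 (monic (Vec.map factor ys))
        (head-monic≢0 (VecAll.map⁺ (VecAll.map (λ {y} → factor≢0 {y}) distinct))) Ds
  in C , (isBiquadratic
       , isXCoordinate x₀ (inj₁ refl)
         ∷ VecAll.lookup⁻ (λ i → isXCoordinate (Vec.lookup ys i) (inj₂ (λ ε → root ε (∈-lookup i ys)))))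
       , new
  where
  factor : ℚ → Germ
  -- Since X = h + x₀² + ε, the factor X - y² of P is h plus this germ.
  factor y = var ⊕ const (x₀ * x₀ - y * y)

  factor≢0 : ∀ {y} → x₀ * x₀ - y * y ≢ 0ℚ → at (factor y) 0ℚ ≢ 0ℚ
  factor≢0 {y} = _∘ trans (sym (+-identityˡ (x₀ * x₀ - y * y)))

  identity : ∀ ε e f → ε + (e - f) + (f - (e + ε)) ≡ 0ℚ
  identity = solve-∀ ring

  root : ∀ ε {y} → y ∈ᵛ ys → horner (monic (Vec.map factor ys)) ε (y * y - (x₀ * x₀ + ε)) ≡ 0ℚ
  root ε {y} y∈ys = horner-monic-root (∈-map⁺ factor y∈ys) (identity ε (x₀ * x₀) (y * y))

-- The degeneration needs a nonzero base abscissa. It is placed at t², or at (t + 1)² when t = 0.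
fixedSquares : ∀ t → Unique (map (λ i → (t + i) ^ 2) offsets) →
  InfinitelyMany (λ C → IsBiquadratic C × All (λ i → IsXCoordinate C ((t + i) ^ 2)) offsets)
fixedSquares t ((d₁ ∷ d₂ ∷ d₃ ∷ d₄ ∷ d₅ ∷ []) ∷ (e₂ ∷ e₃ ∷ e₄ ∷ e₅ ∷ []) ∷ _) = infinitelyMany (new (u o₀ ≟ 0ℚ))
  where
  u : ℚ → ℚ
  u i = (t + i) ^ 2

  differ : ∀ i j → u i ≢ u j → u i * u i - u j * u j ≢ 0ℚ
  differ i j u≢u = p≢q⇒p*p-q*q≢0 u≢u (0≤p^2 (t + i)) (0≤p^2 (t + j))

  o₀ = ℤ.+ 0 / 1
  o₁ = ℤ.+ 1 / 1
  o₂ = ℤ.-[1+ 0 ] / 1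
  o₃ = ℤ.+ 2 / 1
  o₄ = ℤ.-[1+ 1 ] / 1
  o₅ = ℤ.+ 3 / 1

  Curve : (EllipticCurve → Set) → List EllipticCurve → Set
  Curve P Ds = ∃[ C ] (IsBiquadratic C × P C) × All (λ D → ¬ SameJ D C) Ds

  Wanted : EllipticCurve → Set
  Wanted C = All (λ i → IsXCoordinate C (u i)) offsets

  reorder₀ : ∀ {Ds} → Curve (λ C → VecAll (IsXCoordinate C) (u o₀ ∷ u o₁ ∷ u o₂ ∷ u o₃ ∷ u o₄ ∷ u o₅ ∷ [])) Ds → Curve Wanted Ds
  reorder₀ (C , (isBiquadratic , (x₀ ∷ x₁ ∷ x₂ ∷ x₃ ∷ x₄ ∷ x₅ ∷ [])) , distinct) =
    C , (isBiquadratic , (x₀ ∷ x₁ ∷ x₂ ∷ x₃ ∷ x₄ ∷ x₅ ∷ [])) , distinct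

  reorder₁ : ∀ {Ds} → Curve (λ C → VecAll (IsXCoordinate C) (u o₁ ∷ u o₀ ∷ u o₂ ∷ u o₃ ∷ u o₄ ∷ u o₅ ∷ [])) Ds → Curve Wanted Ds
  reorder₁ (C , (isBiquadratic , (x₁ ∷ x₀ ∷ x₂ ∷ x₃ ∷ x₄ ∷ x₅ ∷ [])) , distinct) =
    C , (isBiquadratic , (x₀ ∷ x₁ ∷ x₂ ∷ x₃ ∷ x₄ ∷ x₅ ∷ [])) , distinct

  new : Dec (u o₀ ≡ 0ℚ) → ∀ Ds → Curve Wanted Ds
  new (no u₀≢0) Ds = reorder₀ (newCurve (u o₀) (u o₁ ∷ u o₂ ∷ u o₃ ∷ u o₄ ∷ u o₅ ∷ []) u₀≢0
    (differ o₀ o₁ d₁ ∷ differ o₀ o₂ d₂ ∷ differ o₀ o₃ d₃ ∷ differ o₀ o₄ d₄ ∷ differ o₀ o₅ d₅ ∷ []) Ds)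
  -- As t² = 0, distinctness from t² makes (t + 1)² nonzero.
  new (yes u₀≡0) Ds = reorder₁ (newCurve (u o₁) (u o₀ ∷ u o₂ ∷ u o₃ ∷ u o₄ ∷ u o₅ ∷ []) (d₁ ∘ trans u₀≡0 ∘ sym)
    (differ o₁ o₀ (d₁ ∘ sym) ∷ differ o₁ o₂ e₂ ∷ differ o₁ o₃ e₃ ∷ differ o₁ o₄ e₄ ∷ differ o₁ o₅ e₅ ∷ []) Ds)

theorem3 : (∀ (t : ℚ) → Unique (map (λ i → (t + i) ^ 2) offsets) →
    InfinitelyMany (λ C → IsBiquadratic C × All (λ i → IsXCoordinate C ((t + i) ^ 2)) offsets))
    × InfinitelyMany (λ C → IsBiquadratic C × HasConsecutiveSquares 6 C)
theorem3 = fixedSquares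
         -- With t = 3 the numbers t + i are exactly 1, ..., 6, whose squares are distinct.
         , weaken (fixedSquares 3ℚ (from-yes (allPairs? (λ x y → ¬? (x ≟ y)) (map (λ i → (3ℚ + i) ^ 2) offsets))))
  where
  3ℚ : ℚ
  3ℚ = fromℕ 3

  consecutive : ∀ {C} → All (λ i → IsXCoordinate C ((3ℚ + i) ^ 2)) offsets → HasConsecutiveSquares 6 C
  -- The pattern follows the order 0, 1, -1, 2, -2, 3 of `offsets`, so 3 + i runs through 3, 4, 2,
  -- 5, 1, 6. Indices start at 1, hence u = 0.
  consecutive {C} (x₃ ∷ x₄ ∷ x₂ ∷ x₅ ∷ x₁ ∷ x₆ ∷ []) = proj₁ ∘ point , 0ℚ , proj₂ ∘ point
    where
    point : (i : Fin 6) → IsXCoordinate C ((0ℚ + fromℕ (suc (toℕ i))) ^ 2)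
    point zero                               = x₁
    point (suc zero)                         = x₂
    point (suc (suc zero))                   = x₃
    point (suc (suc (suc zero)))             = x₄
    point (suc (suc (suc (suc zero))))       = x₅
    point (suc (suc (suc (suc (suc zero))))) = x₆

  weaken : InfinitelyMany (λ C → IsBiquadratic C × All (λ i → IsXCoordinate C ((3ℚ + i) ^ 2)) offsets) →
    InfinitelyMany (λ C → IsBiquadratic C × HasConsecutiveSquares 6 C)
  weaken (curve , holds , injective) = curve , (λ n → map₂ (consecutive {curve n}) (holds n)) , injective
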